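{- Let $t \in \Sigma^*$ be a finite trace and $\varphi$ an LTL formula. Then: (1) $t \in [\![\varphi]\!]_3(\mathrm{T}) \iff \forall u \in \Sigma^\omega.\ tu \in [\![\varphi]\!](\mathrm{T})$; (2) $t \in [\![\varphi]\!]_3(\mathrm{F}) \iff \forall u \in \Sigma^\omega.\ tu \in [\![\varphi]\!](\mathrm{F})$.
   Context: Traces. Fix a set $A$ of atomic propositions and let $\Sigma = \mathcal{P}(A)$ be the set of states. $\Sigma^*$ is the set of finite traces (including the empty trace $\varepsilon$), $\Sigma^\omega$ the set of infinite traces, $\Sigma^\infty = \Sigma^* \cup \Sigma^\omega$. Concatenation is written $tu$, with $tu = t$ if $t$ is infinite. $t_0$ is the first state of a nonempty trace $t$; $t|_n$ is $t$ without its first $n$ states ($\varepsilon$ if $n$ exceeds the length of $t$). Definitive sets. For $X \subseteq \Sigma^\infty$, $\downarrow X = \{u \mid \exists t \in X.\ \exists v \in \Sigma^\infty.\ t = uv\}$; $\uparrow t = \{tu \mid u \in \Sigma^\infty\}$; $\mathrm{dp}(X) = \{t \in \Sigma^\infty\mid \uparrow t \subseteq \downarrow X\}$. $X$ is definitive iff $X = \mathrm{dp}(X)$. Definitive union: $X \sqcup Y = \mathrm{dp}(X \cup Y)$ and $\bigsqcup S = \mathrm{dp}(\bigcup S)$. Prepend: $\triangleright X = \{t \in \Sigma^\infty \mid t|_1 \in X\}$. LTL formulae: $\varphi,\psi ::= \top \mid a \mid \neg\varphi \mid \varphi\wedge\psi \mid \bigcirc\varphi \mid \varphi\,\mathcal{U}\,\psi$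 with $a \in A$; $\varphi\vee\psi$ abbreviates $\neg(\neg\varphi\wedge\neg\psi)$. Conventional LTL semantics $[\![\varphi]\!] : \{\mathrm{T},\mathrm{F}\} \to \mathcal{P}(\Sigma^\omega)$, by recursion: $[\![\top]\!](\mathrm{T}) = \Sigma^\omega$, $[\![\top]\!](\mathrm{F}) = \emptyset$; $[\![a]\!](\mathrm{T}) = \{t\in\Sigma^\omega \mid a \in t_0\}$, $[\![a]\!](\mathrm{F}) = \{t\in\Sigma^\omega \mid a \notin t_0\}$; $[\![\neg\varphi]\!](\mathrm{T}) = [\![\varphi]\!](\mathrm{F})$, $[\![\neg\varphi]\!](\mathrm{F}) = [\![\varphi]\!](\mathrm{T})$; $[\![\varphi\wedge\psi]\!](\mathrm{T}) = [\![\varphi]\!](\mathrm{T})\cap[\![\psi]\!](\mathrm{T})$, $[\![\varphi\wedge\psi]\!](\mathrm{F}) = [\![\varphi]\!](\mathrm{F})\cup[\![\psi]\!](\mathrm{F})$; $[\![\bigcirc\varphi]\!](b) = \{t \mid t|_1 \in [\![\varphi]\!](b)\}$ for $b\in\{\mathrm{T},\mathrm{F}\}$; $[\![\varphi\,\mathcal{U}\,\psi]\!](\mathrm{T}) = \{t \mid \exists k.\ (\forall i<k.\ t|_i \in [\![\varphi]\!](\mathrm{T})) \wedge t|_k \in [\![\psi]\!](\mathrm{T})\}$, $[\![\varphi\,\mathcal{U}\,\psi]\!](\mathrm{F}) = \{t \mid \forall k.\ (\exists i<k.\ t|_i \in [\![\varphi]\!](\mathrm{F})) \vee t|_k \in [\![\psi]\!](\mathrm{F})\}$.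 LTL$_3$ semantics $[\![\varphi]\!]_3$ assigns to each answer in $\{\mathrm{T},\mathrm{F}\}$ a definitive set, by recursion: $[\![\top]\!]_3(\mathrm{T}) = \Sigma^\infty$, $[\![\top]\!]_3(\mathrm{F}) = \emptyset$; $[\![a]\!]_3(\mathrm{T}) = \mathrm{dp}\{t\in\Sigma^\infty \mid t\ne\varepsilon \wedge a \in t_0\}$, $[\![a]\!]_3(\mathrm{F}) = \mathrm{dp}\{t\in\Sigma^\infty \mid t\neq\varepsilon \wedge a \notin t_0\}$; $[\![\neg\varphi]\!]_3(\mathrm{T}) = [\![\varphi]\!]_3(\mathrm{F})$, $[\![\neg\varphi]\!]_3(\mathrm{F}) = [\![\varphi]\!]_3(\mathrm{T})$; $[\![\varphi\wedge\psi]\!]_3(\mathrm{T}) = [\![\varphi]\!]_3(\mathrm{T})\cap[\![\psi]\!]_3(\mathrm{T})$, $[\![\varphi\wedge\psi]\!]_3(\mathrm{F}) = [\![\varphi]\!]_3(\mathrm{F})\sqcup[\![\psi]\!]_3(\mathrm{F})$; $[\![\bigcirc\varphi]\!]_3(b) = \triangleright([\![\varphi]\!]_3(b))$ for $b\in\{\mathrm{T},\mathrm{F}\}$; $[\![\varphi\,\mathcal{U}\,\psi]\!]_3(\mathrm{T}) = \bigsqcup_{k\in\mathbb{N}} f^k([\![\psi]\!]_3(\mathrm{T}))$ where $f(X) = \triangleright X \cap [\![\varphi]\!]_3(\mathrm{T})$; $[\![\varphi\,\mathcal{U}\,\psi]\!]_3(\mathrm{F}) = \bigcap_{k\in\mathbb{N}}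 g^k([\![\psi]\!]_3(\mathrm{F}))$ where $g(X) = \triangleright X \sqcup [\![\varphi]\!]_3(\mathrm{F})$. Here $f^k$ is the $k$-fold self-composition of $f$ ($f^0$ the identity). -}

module Defs where

open import Data.List.Base as List using (List; []; _∷_)
open import Data.List.Relation.Binary.Pointwise using (Pointwise)
open import Data.Nat.Base using (ℕ; zero; suc; _+_; _<_)
open import Data.Nat.GeneralisedArithmetic using (fold)
open import Data.Product.Base using (Σ-syntax; ∃-syntax; _×_)
open import Data.Sum.Base using (_⊎_)
import Level
open import Level using (Level)
open import Relation.Binary.PropositionalEquality.Core using (_≡_; _≢_; refl)
open import Relation.Nullary.Negation.Core using (contradiction)
open import Relation.Unary using (Pred; _∈_; _∉_; _⊆_; _≐_; _∩_; _∪_; ⋃; ⋂)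
open import Relation.Unary.Polymorphic using (U; ∅)

infix 4 _≈_

State : ∀ {a} → Set a → Set (Level.suc a)
State {a} A = Pred A a

FinTrace : ∀ {a} → Set a → Set (Level.suc a)
FinTrace A = List (State A)

InfTrace : ∀ {a} → Set a → Set (Level.suc a)
InfTrace A = ℕ → State A

data Trace {a} (A : Set a) : Set (Level.suc a) where
  fin : FinTrace A → Trace A
  inf : InfTrace A → Trace A

-- Equality of traces is pointwise, and states are compared extensionally, as
-- subsets of A; propositional equality would be too fine without function
-- and propositional extensionality.
data _≈_ {a} {A : Set a} : Trace A → Trace A → Set (Level.suc a) where
  fin : ∀ {t u : FinTrace A} → Pointwise _≐_ t u → fin t ≈ fin u
  inf : ∀ {t u : InfTrace A} → (∀ n → t n ≐ u n) → inf t ≈ inf u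

data LTL {a} (A : Set a) : Set a where
  tt   : LTL A
  atom : A → LTL A
  not  : LTL A → LTL A
  _and_ : LTL A → LTL A → LTL A
  next : LTL A → LTL A
  _until_ : LTL A → LTL A → LTL A

data Answer : Set where
  T F : Answer

module _ {a : Level} {A : Set a} where

  infixr 9 ▷_
  infix  9 ↑_ ↓_
  infixr 6 _⊔_
  infixr 5 _++ω_ _⌢_

  ε : Trace A
  ε = fin []

  _++ω_ : FinTrace A → InfTrace A → InfTrace A
  ([]      ++ω u) n       = u n
  ((s ∷ t) ++ω u) zero    = s
  ((s ∷ t) ++ω u) (suc n) = (t ++ω u) n

  _⌢_ : Trace A → Trace A → Trace A
  fin t ⌢ fin u = fin (t List.++ u)
  fin t ⌢ inf u = inf (t ++ω u)
  inf t ⌢ _     = inf t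

  first : (t : Trace A) → t ≢ ε → State A
  first (fin [])      t≢ε = contradiction refl t≢ε
  first (fin (s ∷ _)) _   = s
  first (inf t)       _   = t 0

  dropω : ℕ → InfTrace A → InfTrace A
  dropω n t i = t (n + i)

  drop : ℕ → Trace A → Trace A
  drop n (fin t) = fin (List.drop n t)
  drop n (inf t) = inf (dropω n t)

  ↓_ : ∀ {ℓ} → Pred (Trace A) ℓ → Pred (Trace A) (Level.suc a Level.⊔ ℓ)
  (↓ X) u = ∃[ t ] t ∈ X × (∃[ v ] t ≈ u ⌢ v)

  ↑_ : Trace A → Pred (Trace A) (Level.suc a)
  (↑ t) w = ∃[ u ] w ≈ t ⌢ u

  dp : ∀ {ℓ} → Pred (Trace A) ℓ → Pred (Trace A) (Level.suc a Level.⊔ ℓ)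
  dp X t = ↑ t ⊆ ↓ X

  _⊔_ : ∀ {ℓ₁ ℓ₂} → Pred (Trace A) ℓ₁ → Pred (Trace A) ℓ₂ →
        Pred (Trace A) (Level.suc a Level.⊔ ℓ₁ Level.⊔ ℓ₂)
  X ⊔ Y = dp (X ∪ Y)

  ⨆ : ∀ {i ℓ} (I : Set i) → (I → Pred (Trace A) ℓ) →
      Pred (Trace A) (Level.suc a Level.⊔ i Level.⊔ ℓ)
  ⨆ I X = dp (⋃ I X)

  ▷_ : ∀ {ℓ} → Pred (Trace A) ℓ → Pred (Trace A) ℓ
  (▷ X) t = drop 1 t ∈ X

  ⟦_⟧ : LTL A → Answer → Pred (InfTrace A) a
  ⟦ tt ⟧        T = U
  ⟦ tt ⟧        F = ∅
  ⟦ atom p ⟧    T = λ t → p ∈ t 0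
  ⟦ atom p ⟧    F = λ t → p ∉ t 0
  ⟦ not φ ⟧     T = ⟦ φ ⟧ F
  ⟦ not φ ⟧     F = ⟦ φ ⟧ T
  ⟦ φ and ψ ⟧   T = ⟦ φ ⟧ T ∩ ⟦ ψ ⟧ T
  ⟦ φ and ψ ⟧   F = ⟦ φ ⟧ F ∪ ⟦ ψ ⟧ F
  ⟦ next φ ⟧    b = λ t → dropω 1 t ∈ ⟦ φ ⟧ b
  ⟦ φ until ψ ⟧ T = λ t →
    ∃[ k ] (∀ i → i < k → dropω i t ∈ ⟦ φ ⟧ T) × dropω k t ∈ ⟦ ψ ⟧ T
  ⟦ φ until ψ ⟧ F = λ t →
    ∀ k → (∃[ i ] i < k × dropω i t ∈ ⟦ φ ⟧ F) ⊎ dropω k t ∈ ⟦ ψ ⟧ F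

  ⟦_⟧₃ : LTL A → Answer → Pred (Trace A) (Level.suc a)
  ⟦ tt ⟧₃        T = U
  ⟦ tt ⟧₃        F = ∅
  ⟦ atom p ⟧₃    T = dp λ t → Σ[ t≢ε ∈ t ≢ ε ] p ∈ first t t≢ε
  ⟦ atom p ⟧₃    F = dp λ t → Σ[ t≢ε ∈ t ≢ ε ] p ∉ first t t≢ε
  ⟦ not φ ⟧₃     T = ⟦ φ ⟧₃ F
  ⟦ not φ ⟧₃     F = ⟦ φ ⟧₃ T
  ⟦ φ and ψ ⟧₃   T = ⟦ φ ⟧₃ T ∩ ⟦ ψ ⟧₃ T
  ⟦ φ and ψ ⟧₃   F = ⟦ φ ⟧₃ F ⊔ ⟦ ψ ⟧₃ F
  ⟦ next φ ⟧₃    b = ▷ ⟦ φ ⟧₃ b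
  ⟦ φ until ψ ⟧₃ T = ⨆ ℕ λ k → fold (⟦ ψ ⟧₃ T) (λ X → ▷ X ∩ ⟦ φ ⟧₃ T) k
  ⟦ φ until ψ ⟧₃ F = ⋂ ℕ λ k → fold (⟦ ψ ⟧₃ F) (λ X → ▷ X ⊔ ⟦ φ ⟧₃ F) k

{-# OPTIONS --safe #-}

-- Call P ⊆ Σ^ω the infinite part of X when the infinite traces of X are those
-- of P, and a finite t is in X exactly when all its infinite extensions are in
-- P.  dp X always has an infinite part, namely X ∩ Σ^ω: a finite extension of t
-- is a prefix of an infinite one.  All operations of the LTL₃ semantics preserve
-- this relation, so by induction on φ the infinite part of ⟦ φ ⟧₃ b is ⟦ φ ⟧ b.

module Submission where

open import Defs
open import Data.List.Base as List using ([]; _∷_)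
open import Data.List.Relation.Binary.Pointwise using (Pointwise; []; _∷_)
open import Data.Nat.Base using (ℕ; zero; suc; _<_; s≤s; s<s; z<s)
open import Data.Nat.GeneralisedArithmetic using (fold)
open import Data.Product.Base as Product using (∃-syntax; _×_; _,_; proj₁; proj₂)
open import Data.Sum.Base as Sum using (_⊎_; inj₁; inj₂)
open import Function.Base using (_∘_)
open import Function.Bundles using (_⇔_; mk⇔; module Equivalence)
open import Level using (Level; lift)
open import Relation.Unary using (Pred; _∈_; _≐_; _∩_; _∪_; ⋃; ⋂)
open import Relation.Unary.Polymorphic using (U; ∅)
open import Relation.Unary.Properties using (≐-refl; ≐-sym)

open Equivalence using (to; from)

private
  variable
    a i ℓ ℓ₁ ℓ₂ ℓ₃ ℓ₄ : Level
    A : Set a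

-- The empty state exists over every `A`, so infinite traces always exist; this one is the padding
-- that makes a finite trace infinite.
∅ω : InfTrace A
∅ω _ = ∅

≈-symω : {t u : InfTrace A} → inf t ≈ inf u → inf u ≈ inf t
≈-symω (inf t≐u) = inf λ n → ≐-sym (t≐u n)

++ω-cong : {t u : FinTrace A} → Pointwise _≐_ t u →
           ∀ (v : InfTrace A) n → (t ++ω v) n ≐ (u ++ω v) n
++ω-cong []          v n       = ≐-refl
++ω-cong (s≐r ∷ _)   v zero    = s≐r
++ω-cong (_   ∷ t≐u) v (suc n) = ++ω-cong t≐u v n

++-++ω-assoc : ∀ (t u : FinTrace A) (v : InfTrace A) n →
               (t ++ω u ++ω v) n ≐ ((t List.++ u) ++ω v) n
++-++ω-assoc []      u v n       = ≐-refl
++-++ω-assoc (s ∷ t) u v zero    = ≐-refl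
++-++ω-assoc (s ∷ t) u v (suc n) = ++-++ω-assoc t u v n

≈-dropω : ∀ k {t u : InfTrace A} → inf t ≈ inf u → inf (dropω k t) ≈ inf (dropω k u)
≈-dropω k (inf t≐u) = inf λ n → t≐u _

-- `↑_` and `↓_` see traces only up to `≈`, whereas an arbitrary predicate may separate traces
-- related by `≈`.
Respects-≈ : {A : Set a} → Pred (InfTrace A) ℓ → Set _
Respects-≈ P = ∀ {t u} → inf t ≈ inf u → t ∈ P → u ∈ P

record InfinitePart {A : Set a} (X : Pred (Trace A) ℓ₁) (P : Pred (InfTrace A) ℓ₂) :
                    Set (Level.suc a Level.⊔ ℓ₁ Level.⊔ ℓ₂) where
  field
    respects : Respects-≈ P
    infinite : ∀ u → inf u ∈ X ⇔ u ∈ P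
    finite   : ∀ t → fin t ∈ X ⇔ (∀ u → t ++ω u ∈ P)

open InfinitePart

module _ {A : Set a} where

  -- Serves to trade one unfolding of an iterate for the closed formula of `Until` or `Release`.
  InfinitePart-resp-≐ : {X : Pred (Trace A) ℓ₁} {P : Pred (InfTrace A) ℓ₂}
                        {Q : Pred (InfTrace A) ℓ₃} → P ≐ Q →
                        InfinitePart X P → InfinitePart X Q
  InfinitePart-resp-≐ (P⊆Q , Q⊆P) x .respects t≈u = P⊆Q ∘ respects x t≈u ∘ Q⊆P
  InfinitePart-resp-≐ (P⊆Q , Q⊆P) x .infinite u =
    mk⇔ (P⊆Q ∘ to (infinite x u)) (from (infinite x u) ∘ Q⊆P)
  InfinitePart-resp-≐ (P⊆Q , Q⊆P) x .finite t =
    mk⇔ (λ t∈X u → P⊆Q (to (finite x t) t∈X u)) (λ h → from (finite x t) (λ u → Q⊆P (h u)))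

  U-infinitePart : InfinitePart {A = A} (U {ℓ = ℓ₁}) (U {ℓ = ℓ₂})
  U-infinitePart .respects _ _ = _
  U-infinitePart .infinite _   = mk⇔ _ _
  U-infinitePart .finite _     = mk⇔ _ _

  ∅-infinitePart : InfinitePart {A = A} (∅ {ℓ = ℓ₁}) (∅ {ℓ = ℓ₂})
  ∅-infinitePart .respects _ (lift ())
  ∅-infinitePart .infinite _ = mk⇔ (λ ()) (λ ())
  -- `h` cannot hold vacuously: there is an infinite trace to apply it to.
  ∅-infinitePart .finite _   = mk⇔ (λ ()) (λ h → lift (Level.lower (h ∅ω)))

  -- Up to `≈`, an infinite trace has only itself as a continuation, so for it membership in `dp X`,
  -- in `↓ X` and in `P` coincide.
  dp-infinitePart : {X : Pred (Trace A) ℓ₁} {P : Pred (InfTrace A) ℓ₂} → Respects-≈ P →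
                    (∀ u → inf u ∈ X ⇔ u ∈ P) → InfinitePart (dp X) P
  dp-infinitePart {X = X} {P} resp infX = record
    { respects = resp
    ; infinite = λ u → mk⇔
        (λ u∈dp → ↓-inf (u∈dp (ε , inf λ _ → ≐-refl)))
        (λ { u∈P (_ , w≈u@(inf _)) → inf-↓ (resp (≈-symω w≈u) u∈P) })
    ; finite   = λ t → mk⇔
        (λ t∈dp u → ↓-inf (t∈dp (inf u , inf λ _ → ≐-refl)))
        (λ { h (inf u , w≈tu@(inf _)) → inf-↓ (resp (≈-symω w≈tu) (h u))
           -- A finite continuation of `t` by `u` is padded with `∅ω`; the padded trace lies in `X`,
           -- and `inf ∅ω` is what remains after the prefix.
           ; h (fin u , fin w≐tu) →
               _ , from (infX _) (h (u ++ω ∅ω)) , inf ∅ω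
                 , inf λ n → ++ω-trans t u w≐tu n })
    }
    where
    ↓-inf : ∀ {u} → inf u ∈ ↓ X → u ∈ P
    ↓-inf (_ , w∈X , _ , w≈u@(inf _)) = resp w≈u (to (infX _) w∈X)

    inf-↓ : ∀ {u} → u ∈ P → inf u ∈ ↓ X
    inf-↓ u∈P = _ , from (infX _) u∈P , ε , inf λ _ → ≐-refl

    ++ω-trans : ∀ t u {w} → Pointwise _≐_ w (t List.++ u) →
                ∀ n → (t ++ω u ++ω ∅ω) n ≐ (w ++ω ∅ω) n
    ++ω-trans t u w≐tu n =
      let p , p⁻¹ = ++-++ω-assoc t u ∅ω n
          q , q⁻¹ = ++ω-cong w≐tu ∅ω n
      in q⁻¹ ∘ p , p⁻¹ ∘ q

  module _ {X : Pred (Trace A) ℓ₁} {P : Pred (InfTrace A) ℓ₂} where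

    ▷-infinitePart : InfinitePart X P → InfinitePart (▷ X) (P ∘ dropω 1)
    ▷-infinitePart x .respects t≈u    = respects x (≈-dropω 1 t≈u)
    ▷-infinitePart x .infinite u      = infinite x (dropω 1 u)
    -- `dropω 1 ((s ∷ t) ++ω u)` is `t ++ω u` by computation and eta.
    ▷-infinitePart x .finite (s ∷ t)  = finite x t
    -- Every infinite trace is the tail of some infinite trace.
    ▷-infinitePart x .finite []       = mk⇔
      (λ ε∈X u → to (finite x []) ε∈X (dropω 1 u))
      (λ h → from (finite x []) (λ u → h ((∅ ∷ []) ++ω u)))

    module _ {Y : Pred (Trace A) ℓ₃} {Q : Pred (InfTrace A) ℓ₄}
             (x : InfinitePart X P) (y : InfinitePart Y Q) where

      ∩-infinitePart : InfinitePart (X ∩ Y) (P ∩ Q)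
      ∩-infinitePart .respects t≈u = Product.map (respects x t≈u) (respects y t≈u)
      ∩-infinitePart .infinite u   = mk⇔
        (Product.map (to   (infinite x u)) (to   (infinite y u)))
        (Product.map (from (infinite x u)) (from (infinite y u)))
      ∩-infinitePart .finite t     = mk⇔
        (λ (p , q) u → to (finite x t) p u , to (finite y t) q u)
        (λ h → from (finite x t) (proj₁ ∘ h) , from (finite y t) (proj₂ ∘ h))

      -- Quantifying over all continuations of a finite trace does not commute with a union, as some
      -- may lie in `P` and others in `Q`; the `dp` in `⊔` absorbs these cases.
      ⊔-infinitePart : InfinitePart (X ⊔ Y) (P ∪ Q)
      ⊔-infinitePart = dp-infinitePart
        (λ t≈u → Sum.map (respects x t≈u) (respects y t≈u))
        (λ u → mk⇔ (Sum.map (to   (infinite x u)) (to   (infinite y u)))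
                   (Sum.map (from (infinite x u)) (from (infinite y u))))

  module _ {I : Set i} {X : I → Pred (Trace A) ℓ₁} {P : I → Pred (InfTrace A) ℓ₂}
           (x : ∀ j → InfinitePart (X j) (P j)) where

    ⋂-infinitePart : InfinitePart (⋂ I X) (⋂ I P)
    ⋂-infinitePart .respects t≈u t∈P j = respects (x j) t≈u (t∈P j)
    ⋂-infinitePart .infinite u = mk⇔
      (λ h j → to   (infinite (x j) u) (h j))
      (λ h j → from (infinite (x j) u) (h j))
    ⋂-infinitePart .finite t = mk⇔
      (λ h u j → to (finite (x j) t) (h j) u)
      (λ h j → from (finite (x j) t) (λ u → h u j))

    ⨆-infinitePart : InfinitePart (⨆ I X) (⋃ I P)
    ⨆-infinitePart = dp-infinitePart
      (λ t≈u (j , t∈P) → j , respects (x j) t≈u t∈P)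
      (λ u → mk⇔ (Product.map₂ λ {j} → to   (infinite (x j) u))
                 (Product.map₂ λ {j} → from (infinite (x j) u)))

  -- Chosen so that, for truth sets `P` and `Q`, `⋃ ℕ (Until P Q)` is definitionally the truth set
  -- of the until formula.
  Until : Pred (InfTrace A) ℓ₁ → Pred (InfTrace A) ℓ₂ → ℕ → Pred (InfTrace A) _
  Until P Q k t = (∀ i → i < k → dropω i t ∈ P) × dropω k t ∈ Q

  -- Dually, for falsity sets `P` and `Q`, `⋂ ℕ (Release P Q)` is definitionally the falsity set of
  -- the until formula.
  Release : Pred (InfTrace A) ℓ₁ → Pred (InfTrace A) ℓ₂ → ℕ → Pred (InfTrace A) _
  Release P Q k t = (∃[ i ] i < k × dropω i t ∈ P) ⊎ dropω k t ∈ Q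

  module _ (P : Pred (InfTrace A) ℓ₁) (Q : Pred (InfTrace A) ℓ₂) where

    Until-zero : Q ≐ Until P Q 0
    Until-zero = (λ q → (λ _ ()) , q) , proj₂

    -- Position 0 splits off from the positions below `suc k`. As `dropω i (dropω 1 t)` and
    -- `dropω (suc i) t` agree definitionally, only indices need shifting.
    Until-suc : ∀ k → (Until P Q k ∘ dropω 1) ∩ P ≐ Until P Q (suc k)
    Until-suc k =
        (λ { ((ps , q) , p) → (λ { zero _ → p ; (suc i) (s≤s i<k) → ps i i<k }) , q })
      , (λ (ps , q) → ((λ i i<k → ps (suc i) (s<s i<k)) , q) , ps 0 z<s)

    Release-zero : Q ≐ Release P Q 0
    Release-zero = inj₂ , λ { (inj₁ (_ , () , _)) ; (inj₂ q) → q }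

    Release-suc : ∀ k → (Release P Q k ∘ dropω 1) ∪ P ≐ Release P Q (suc k)
    Release-suc k =
        (λ { (inj₁ (inj₁ (i , i<k , p))) → inj₁ (suc i , s<s i<k , p)
           ; (inj₁ (inj₂ q))             → inj₂ q
           ; (inj₂ p)                    → inj₁ (0 , z<s , p) })
      , (λ { (inj₁ (zero  , _       , p)) → inj₂ p
           ; (inj₁ (suc i , s≤s i<k , p)) → inj₁ (inj₁ (i , i<k , p))
           ; (inj₂ q)                     → inj₁ (inj₂ q) })

  -- At level `suc a` the operator `⊔` stays in the same level, so `fold` can iterate inside one
  -- type.
  module _ {X Y : Pred (Trace A) (Level.suc a)}
           {P : Pred (InfTrace A) ℓ₁} {Q : Pred (InfTrace A) ℓ₂}
           (x : InfinitePart X P) (y : InfinitePart Y Q) where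

    -- `fold` adds its steps on the outside, so the induction meets each new requirement at position
    -- 0, as in `Until-suc`.
    Until-infinitePart : ∀ k → InfinitePart (fold Y (λ Z → ▷ Z ∩ X) k) (Until P Q k)
    Until-infinitePart zero    = InfinitePart-resp-≐ (Until-zero P Q) y
    Until-infinitePart (suc k) = InfinitePart-resp-≐ (Until-suc P Q k)
      (∩-infinitePart (▷-infinitePart (Until-infinitePart k)) x)

    Release-infinitePart : ∀ k → InfinitePart (fold Y (λ Z → ▷ Z ⊔ X) k) (Release P Q k)
    Release-infinitePart zero    = InfinitePart-resp-≐ (Release-zero P Q) y
    Release-infinitePart (suc k) = InfinitePart-resp-≐ (Release-suc P Q k)
      (⊔-infinitePart (▷-infinitePart (Release-infinitePart k)) x)

  ⟦_⟧₃-infinitePart : ∀ (φ : LTL A) b → InfinitePart (⟦ φ ⟧₃ b) (⟦ φ ⟧ b)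
  ⟦ tt ⟧₃-infinitePart        T = U-infinitePart
  ⟦ tt ⟧₃-infinitePart        F = ∅-infinitePart
  ⟦ atom p ⟧₃-infinitePart    T = dp-infinitePart
    (λ { (inf t≐u) → proj₁ (t≐u 0) })
    -- `first` of `inf u` is `u 0` for any proof of nonemptiness, and `λ ()` supplies one.
    (λ u → mk⇔ proj₂ ((λ ()) ,_))
  ⟦ atom p ⟧₃-infinitePart    F = dp-infinitePart
    -- Falsity of an atom is contravariant in the state, hence the other inclusion.
    (λ { (inf t≐u) p∉t → p∉t ∘ proj₂ (t≐u 0) })
    (λ u → mk⇔ proj₂ ((λ ()) ,_))
  ⟦ not φ ⟧₃-infinitePart     T = ⟦ φ ⟧₃-infinitePart F
  ⟦ not φ ⟧₃-infinitePart     F = ⟦ φ ⟧₃-infinitePart T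
  ⟦ φ and ψ ⟧₃-infinitePart   T = ∩-infinitePart (⟦ φ ⟧₃-infinitePart T) (⟦ ψ ⟧₃-infinitePart T)
  ⟦ φ and ψ ⟧₃-infinitePart   F = ⊔-infinitePart (⟦ φ ⟧₃-infinitePart F) (⟦ ψ ⟧₃-infinitePart F)
  ⟦ next φ ⟧₃-infinitePart    b = ▷-infinitePart (⟦ φ ⟧₃-infinitePart b)
  ⟦ φ until ψ ⟧₃-infinitePart T =
    ⨆-infinitePart (Until-infinitePart (⟦ φ ⟧₃-infinitePart T) (⟦ ψ ⟧₃-infinitePart T))
  ⟦ φ until ψ ⟧₃-infinitePart F =
    ⋂-infinitePart (Release-infinitePart (⟦ φ ⟧₃-infinitePart F) (⟦ ψ ⟧₃-infinitePart F))

theorem6 : ∀ {a : Level} (A : Set a) (t : FinTrace A) (φ : LTL A) →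
    (fin t ∈ ⟦ φ ⟧₃ T ⇔ (∀ (u : InfTrace A) → t ++ω u ∈ ⟦ φ ⟧ T)) ×
    (fin t ∈ ⟦ φ ⟧₃ F ⇔ (∀ (u : InfTrace A) → t ++ω u ∈ ⟦ φ ⟧ F))
theorem6 A t φ = finite (⟦ φ ⟧₃-infinitePart T) t , finite (⟦ φ ⟧₃-infinitePart F) t
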